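{- Let $G$ be a graph on $n$ vertices with minimum degree $\delta(G)\geq 1$. Then $f_o(G)\geq \frac{n}{10000}$; that is, $G$ contains a set $V_0\subseteq V(G)$ with $|V_0|\geq n/10000$ such that every vertex of the induced subgraph $G[V_0]$ has odd degree in $G[V_0]$.
   Context: All graphs are finite and simple. For a graph $G$, $f_o(G)=\max\{|V_0| : V_0\subseteq V(G),\ G[V_0]\text{ has all degrees odd}\}$, where $G[V_0]$ denotes the subgraph induced by $V_0$. -}

module Defs where

open import Data.Nat using (ℕ; zero; suc; _+_; _*_; _≥_)
open import Data.Bool using (Bool; true; false; _∧_; if_then_else_)
open import Data.Fin using (Fin)
import Data.Fin as Fin
open import Data.Fin.Subset using (Subset; _∈_; ∣_∣)
open import Data.Vec using (lookup)
open import Relation.Binary.PropositionalEquality using (_≡_)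
open import Data.Product using (∃)

Odd : ℕ → Set
Odd d = ∃ λ k → d ≡ suc (2 * k)

record Graph (n : ℕ) : Set where
  field
    adj        : Fin n → Fin n → Bool
    adj-sym    : ∀ u v → adj u v ≡ adj v u
    adj-irrefl : ∀ v → adj v v ≡ false
open Graph public

countTrue : ∀ {n} → (Fin n → Bool) → ℕ
countTrue {zero}  p = 0
countTrue {suc n} p = (if p Fin.zero then 1 else 0) + countTrue (λ i → p (Fin.suc i))

degree : ∀ {n} → Graph n → Fin n → ℕ
degree G v = countTrue (adj G v)

minDegree≥ : ∀ {n} → Graph n → ℕ → Set
minDegree≥ G k = ∀ v → degree G v ≥ k

inducedDegree : ∀ {n} → Graph n → Subset n → Fin n → ℕ
inducedDegree G V₀ v = countTrue (λ u → lookup V₀ u ∧ adj G v u)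

AllOddInduced : ∀ {n} → Graph n → Subset n → Set
AllOddInduced G V₀ = ∀ v → v ∈ V₀ → Odd (inducedDegree G V₀ v)

{-# OPTIONS --safe #-}
module Submission where

-- If V = D ⊔ P and every vertex has an odd number of neighbours across the cut, then V splits
-- into two sets inducing subgraphs with all degrees odd. Over 𝔽₂ such a splitting is a solution
-- x of L x = 1 + deg with L the Laplacian; deg is the diagonal of the symmetric matrix L, hence
-- in its column space, and 1 = L 1_D by the hypothesis on the cut. So it suffices to find a large
-- D ⊔ P with odd cross degrees, a question about bipartite graphs without isolated vertices
-- (split the vertices into a maximal independent set and its complement), which Scott's
-- argument settles. The resulting bound is n / 8.

open import Defs
open import Data.Nat using (ℕ; _*_; _≥_)
open import Data.Fin.Subset using (Subset; ∣_∣)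
open import Data.Product using (Σ; _×_)
open import Data.Bool using (Bool; true; false; _∧_; _xor_; not; if_then_else_)
open import Data.Bool.Properties using (xor-∧-commutativeRing; xor-identityʳ; xor-same; ∧-comm; ∧-assoc; ∧-idem; ∧-zeroʳ; ∧-distribˡ-xor; ∧-distribʳ-xor; ⇔→≡; not-involutive)
import Data.Bool.Properties as Bool
open import Algebra.Bundles using (CommutativeRing)
open import Algebra.Properties.Semiring.Sum (CommutativeRing.semiring xor-∧-commutativeRing)
  using (sum; sum-syntax; sum-cong-≗; sum-replicate-zero; ∑-distrib-+; ∑-comm; *-distribˡ-sum)
open import Data.Fin using (Fin; zero; suc)
open import Data.Fin.Properties using (_≟_; any?; all?; suc-injective)
open import Data.Nat using (zero; suc; _+_; _≤_; _<_; z≤n; s≤s)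
open import Data.Nat.Properties using (≤-refl; ≤-reflexive; ≤-trans; ≤-total; m≤n⇒m≤1+n; m≤m+n; +-mono-≤; +-monoʳ-≤; +-comm; *-monoʳ-≤; *-distribʳ-+; *-assoc; *-mono-≤; module ≤-Reasoning)
open import Data.Nat.Solver using (module +-*-Solver)
open import Data.Product using (∃; _,_; proj₁; proj₂)
open import Data.Sum using (_⊎_; inj₁; inj₂; [_,_]′; swap)
open import Data.Vec using (tabulate; lookup)
open import Data.Vec.Properties using (lookup∘tabulate; []=⇒lookup)
open import Data.Vec.Functional using (_∷_)
open import Function using (_∘_; mk⇔)
open import Relation.Binary.PropositionalEquality using (_≡_; _≢_; refl; sym; trans; cong; cong₂; subst; module ≡-Reasoning)
open import Relation.Nullary using (¬_; Dec; yes; no; does; contradiction)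
open import Relation.Nullary.Decidable using (dec-true; dec-false; _×-dec_; _⊎-dec_; _→-dec_)

private
  variable
    m n : ℕ

-- Boolean case analysis

∧-true : ∀ {x y} → x ≡ true → y ≡ true → x ∧ y ≡ true
∧-true refl refl = refl

∧-trueˡ : ∀ {x y} → x ∧ y ≡ true → x ≡ true
∧-trueˡ {true} _ = refl

∧-trueʳ : ∀ {x y} → x ∧ y ≡ true → y ≡ true
∧-trueʳ {true} y≡true = y≡true

true≢false : ∀ {x} → x ≡ true → x ≢ false
true≢false refl ()

not-true⇒false : ∀ {x} → not x ≡ true → x ≡ false
not-true⇒false {false} _ = refl

∧-rotate : ∀ a b c → a ∧ (b ∧ c) ≡ c ∧ (b ∧ a)
∧-rotate a b c = trans (∧-comm a (b ∧ c)) (trans (cong (_∧ a) (∧-comm b c)) (∧-assoc c b a))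

xor-true : ∀ x {y} → x xor y ≡ true → x ≡ true ⊎ y ≡ true
xor-true true  _ = inj₁ refl
xor-true false p = inj₂ p

δ : Fin n → Fin n → Bool
δ a b = does (a ≟ b)

δ⇒≡ : {a b : Fin n} → δ a b ≡ true → a ≡ b
δ⇒≡ {a = a} {b} p with a ≟ b
... | yes a≡b = a≡b
... | no  _   = contradiction p λ ()

≡⇒δ : {a b : Fin n} → a ≡ b → δ a b ≡ true
≡⇒δ {a = a} {b} a≡b = dec-true (a ≟ b) a≡b

_∖_ : (Fin n → Bool) → Fin n → Fin n → Bool
(D ∖ d) v = D v ∧ not (δ v d)

∈-∖ : (D : Fin n → Bool) {d v : Fin n} → D v ≡ true → v ≢ d → (D ∖ d) v ≡ true
∈-∖ D {d} {v} v∈D v≢d = ∧-true v∈D (cong not (dec-false (v ≟ d) v≢d))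

∉-∖ : (D : Fin n → Bool) (d : Fin n) → (D ∖ d) d ≡ false
∉-∖ D d = trans (cong (λ b → D d ∧ not b) (dec-true (d ≟ d) refl)) (∧-zeroʳ (D d))

-- Counting

bit : Bool → ℕ
bit b = if b then 1 else 0

countTrue-∪ : (p q r : Fin n → Bool) → (∀ i → p i ≡ true → q i ≡ true ⊎ r i ≡ true) →
              countTrue p ≤ countTrue q + countTrue r
countTrue-∪ {zero}  p q r cover = z≤n
countTrue-∪ {suc n} p q r cover =
  ≤-trans (+-mono-≤ (bit-∪ (p zero) (q zero) (r zero) (cover zero)) (countTrue-∪ _ _ _ (cover ∘ suc)))
          (≤-reflexive (solve 4 (λ a b c d → (a :+ b) :+ (c :+ d) := (a :+ c) :+ (b :+ d)) refl
                         (bit (q zero)) (bit (r zero)) _ _))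
  where
  open +-*-Solver
  bit-∪ : ∀ a b c → (a ≡ true → b ≡ true ⊎ c ≡ true) → bit a ≤ bit b + bit c
  bit-∪ false b c _ = z≤n
  bit-∪ true  b c f with f refl
  ... | inj₁ refl = s≤s z≤n
  bit-∪ true false c f | inj₂ refl = s≤s z≤n
  bit-∪ true true  c f | inj₂ refl = s≤s z≤n

countTrue-disjoint : (p q r : Fin n → Bool) → (∀ i → p i ≡ true → r i ≡ true) →
                     (∀ i → q i ≡ true → r i ≡ true) → (∀ i → p i ≡ true → q i ≡ false) →
                     countTrue p + countTrue q ≤ countTrue r
countTrue-disjoint {zero}  p q r p⊆r q⊆r disj = z≤n
countTrue-disjoint {suc n} p q r p⊆r q⊆r disj =
  ≤-trans (≤-reflexive (solve 4 (λ a b c d → (a :+ c) :+ (b :+ d) := (a :+ b) :+ (c :+ d)) refl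
                         (bit (p zero)) (bit (q zero)) _ _))
          (+-mono-≤ (bit-disjoint (p zero) (q zero) (r zero) (p⊆r zero) (q⊆r zero) (disj zero))
                    (countTrue-disjoint _ _ _ (p⊆r ∘ suc) (q⊆r ∘ suc) (disj ∘ suc)))
  where
  open +-*-Solver
  bit-disjoint : ∀ a b c → (a ≡ true → c ≡ true) → (b ≡ true → c ≡ true) → (a ≡ true → b ≡ false) →
                 bit a + bit b ≤ bit c
  bit-disjoint false false c f g h = z≤n
  bit-disjoint false true  c f g h rewrite g refl = ≤-refl
  bit-disjoint true  b     c f g h rewrite f refl | h refl = ≤-refl

countTrue-false : ∀ n → countTrue {n} (λ _ → false) ≡ 0
countTrue-false zero    = refl
countTrue-false (suc n) = countTrue-false n

countTrue-true : ∀ n → countTrue {n} (λ _ → true) ≡ n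
countTrue-true zero    = refl
countTrue-true (suc n) = cong suc (countTrue-true n)

countTrue-mono : (p q : Fin n → Bool) → (∀ i → p i ≡ true → q i ≡ true) → countTrue p ≤ countTrue q
countTrue-mono {n} p q p⊆q = begin
  countTrue p                              ≤⟨ countTrue-∪ p q (λ _ → false) (λ i → inj₁ ∘ p⊆q i) ⟩
  countTrue q + countTrue {n} (λ _ → false) ≡⟨ cong (countTrue q +_) (countTrue-false n) ⟩
  countTrue q + 0                          ≡⟨ +-comm _ 0 ⟩
  countTrue q                              ∎
  where open ≤-Reasoning

countTrue-strict : (p q : Fin n → Bool) → (∀ i → p i ≡ true → q i ≡ true) →
                   ∀ d → q d ≡ true → p d ≡ false → countTrue p < countTrue q
countTrue-strict p q p⊆q zero    d∈q d∉p rewrite d∈q | d∉p = s≤s (countTrue-mono _ _ (p⊆q ∘ suc))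
countTrue-strict p q p⊆q (suc d) d∈q d∉p with p zero | q zero | p⊆q zero
... | false | false | _ = countTrue-strict _ _ (p⊆q ∘ suc) d d∈q d∉p
... | false | true  | _ = m≤n⇒m≤1+n (countTrue-strict _ _ (p⊆q ∘ suc) d d∈q d∉p)
... | true  | true  | _ = s≤s (countTrue-strict _ _ (p⊆q ∘ suc) d d∈q d∉p)
... | true  | false | f = contradiction (f refl) λ ()

countTrue-δ : (a : Fin n) → countTrue (δ a) ≤ 1
countTrue-δ {suc n} zero    = s≤s (≤-reflexive (countTrue-false n))
countTrue-δ {suc n} (suc a) =
  ≤-trans (countTrue-mono (δ (suc a) ∘ suc) (δ a) (λ i p → ≡⇒δ {a = a} (suc-injective (δ⇒≡ {a = suc a} p)))) (countTrue-δ a)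

countTrue>0 : (p : Fin n → Bool) → countTrue p ≥ 1 → ∃ λ i → p i ≡ true
countTrue>0 {suc n} p c with p zero in eq
... | true  = zero , eq
... | false = let i , pi = countTrue>0 (p ∘ suc) c in suc i , pi

∣tabulate∣ : (S : Fin n → Bool) → ∣ tabulate S ∣ ≡ countTrue S
∣tabulate∣ {zero}  S = refl
∣tabulate∣ {suc n} S with S zero
... | true  = cong suc (∣tabulate∣ (S ∘ suc))
... | false = ∣tabulate∣ (S ∘ suc)

-- Linear algebra over 𝔽₂, with xor as addition and ∧ as multiplication

sum-true⇒∃ : (p : Fin n → Bool) → sum p ≡ true → ∃ λ i → p i ≡ true
sum-true⇒∃ {suc n} p s with p zero in eq
... | true  = zero , eq
... | false = let i , pi = sum-true⇒∃ (p ∘ suc) s in suc i , pi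

sum-false : (p : Fin n → Bool) → (∀ i → p i ≡ false) → sum p ≡ false
sum-false {n} p p≡0 = trans (sum-cong-≗ p≡0) (sum-replicate-zero n)

-- The induction has to carry the even case along with the odd one, since a leading `true` exchanges
-- the two parities.
sum-true⇒Odd : (p : Fin n → Bool) → sum p ≡ true → Odd (countTrue p)
sum-true⇒Odd p s = subst (λ b → if b then Odd (countTrue p) else Even (countTrue p)) s (parity p)
  where
  open +-*-Solver
  Even : ℕ → Set
  Even k = ∃ λ j → k ≡ 2 * j
  parity : ∀ {n} (p : Fin n → Bool) → if sum p then Odd (countTrue p) else Even (countTrue p)
  parity {zero}  p = 0 , refl
  parity {suc n} p with p zero | sum (p ∘ suc) | parity (p ∘ suc)
  ... | false | _     | ih      = ih
  ... | true  | false | j , eq = j , cong suc eq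
  ... | true  | true  | j , eq = suc j , trans (cong suc eq) (solve 1 (λ x → con 2 :+ con 2 :* x := con 2 :* (con 1 :+ x)) refl j)

∑-δ : (a : Fin n) (f : Fin n → Bool) → ∑[ i < n ] (δ a i ∧ f i) ≡ f a
∑-δ {suc n} zero    f = trans (cong (f zero xor_) (sum-replicate-zero n)) (xor-identityʳ (f zero))
∑-δ {suc n} (suc a) f = trans (sum-cong-≗ (λ i → cong (_∧ f (suc i)) (δ-suc i))) (∑-δ a (f ∘ suc))
  where
  δ-suc : ∀ i → δ (suc a) (suc i) ≡ δ a i
  δ-suc i with a ≟ i
  ... | yes _ = refl
  ... | no  _ = refl

-- The sum is the image of `e` under `p` with multiplicities taken mod 2. A marked point has some
-- preimage in `e`, and each element of `e` contributes at most one point.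
countTrue-image : (e : Fin m → Bool) (p : Fin m → Fin n) →
                  countTrue (λ i → ∑[ d < m ] (e d ∧ δ (p d) i)) ≤ countTrue e
countTrue-image {zero}  {n} e p = ≤-reflexive (countTrue-false n)
countTrue-image {suc m} {n} e p =
  ≤-trans (countTrue-∪ _ (λ i → e zero ∧ δ (p zero) i) _ (λ i → xor-true (e zero ∧ δ (p zero) i)))
          (+-mono-≤ (head-bound (e zero)) (countTrue-image (e ∘ suc) (p ∘ suc)))
  where
  head-bound : ∀ b → countTrue (λ i → b ∧ δ (p zero) i) ≤ bit b
  head-bound true  = countTrue-δ (p zero)
  head-bound false = ≤-reflexive (countTrue-false n)

infixl 7 _·_

_·_ : (Fin n → Bool) → (Fin n → Bool) → Bool
x · y = sum (λ i → x i ∧ y i)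

·-comm : (x y : Fin n → Bool) → x · y ≡ y · x
·-comm x y = sum-cong-≗ (λ i → ∧-comm (x i) (y i))

·-xorˡ : (x y z : Fin n → Bool) → (λ i → x i xor y i) · z ≡ (x · z) xor (y · z)
·-xorˡ x y z = trans (sum-cong-≗ (λ i → ∧-distribʳ-xor (z i) (x i) (y i))) (∑-distrib-+ (λ i → x i ∧ z i) (λ i → y i ∧ z i))

·-xorʳ : (x y z : Fin n → Bool) → x · (λ i → y i xor z i) ≡ (x · y) xor (x · z)
·-xorʳ x y z = trans (sum-cong-≗ (λ i → ∧-distribˡ-xor (x i) (y i) (z i))) (∑-distrib-+ (λ i → x i ∧ y i) (λ i → x i ∧ z i))

-- Comparing the alternatives for b and for b + v decides the one for v ∷ vs:
-- if both fail, with witnesses y and y′, then one of y, y′, y + y′ also annihilates v.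
fredholm : (v : Fin m → Fin n → Bool) (b : Fin n → Bool) →
           (∃ λ (x : Fin m → Bool) → ∀ i → ∑[ j < m ] (x j ∧ v j i) ≡ b i) ⊎
           (∃ λ (y : Fin n → Bool) → (∀ j → v j · y ≡ false) × b · y ≡ true)
fredholm {zero} v b with any? (λ i → b i Bool.≟ true)
... | yes (i , bi) = inj₂ (δ i , (λ ()) , trans (·-comm b (δ i)) (trans (∑-δ i b) bi))
... | no  ¬b       = inj₁ ((λ ()) , λ i → sym (Bool.¬-not (λ bi → ¬b (i , bi))))
fredholm {suc m} v b with fredholm (v ∘ suc) b
... | inj₁ (x , eq) = inj₁ (false ∷ x , eq)
... | inj₂ (y , y⊥vs , by) with v zero · y in vy
...   | false = inj₂ (y , (λ { zero → vy ; (suc j) → y⊥vs j }) , by)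
...   | true with fredholm (v ∘ suc) (λ i → v zero i xor b i)
-- Here `v zero + b` is a combination of the remaining rows. Including `v zero` as well gives `b`,
-- because adding `v zero` twice cancels.
...     | inj₁ (x , eq) = inj₁ (true ∷ x , λ i → trans (cong (v zero i xor_) (eq i)) (xor-cancel (v zero i) (b i)))
  where
  xor-cancel : ∀ a c → a xor (a xor c) ≡ c
  xor-cancel false c = refl
  xor-cancel true  c = not-involutive c
...     | inj₂ (y′ , y′⊥vs , bvy′) with v zero · y′ in vy′ | trans (sym (·-xorˡ (v zero) b y′)) bvy′
...       | false | by′ = inj₂ (y′ , (λ { zero → vy′ ; (suc j) → y′⊥vs j }) , by′)
...       | true  | by′ = inj₂ ((λ i → y i xor y′ i) ,
              (λ { zero    → trans (·-xorʳ (v zero) y y′) (cong₂ _xor_ vy vy′)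
                 ; (suc j) → trans (·-xorʳ (v (suc j)) y y′) (cong₂ _xor_ (y⊥vs j) (y′⊥vs j)) }) ,
              trans (·-xorʳ b y y′) (cong₂ _xor_ by (not-true⇒false by′)))

-- Mod 2 the entries at `(i , j)` and `(j , i)` cancel, which leaves only the zero diagonal. The
-- induction peels off the first row and the first column, equal by symmetry.
∑∑-alternating : (B : Fin n → Fin n → Bool) → (∀ i j → B i j ≡ B j i) → (∀ i → B i i ≡ false) →
                 ∑[ i < n ] ∑[ j < n ] B i j ≡ false
∑∑-alternating {zero}  B B-sym B-diag = refl
∑∑-alternating {suc n} B B-sym B-diag = begin
  (B zero zero xor row) xor ∑[ i < n ] (B (suc i) zero xor ∑[ j < n ] B (suc i) (suc j))
    ≡⟨ cong₂ _xor_ (cong (_xor row) (B-diag zero)) (∑-distrib-+ (λ i → B (suc i) zero) _) ⟩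
  row xor (∑[ i < n ] B (suc i) zero xor ∑[ i < n ] ∑[ j < n ] B (suc i) (suc j))
    ≡⟨ cong (row xor_) (cong₂ _xor_ (sum-cong-≗ (λ i → B-sym (suc i) zero))
         (∑∑-alternating (λ i j → B (suc i) (suc j)) (λ i j → B-sym (suc i) (suc j)) (B-diag ∘ suc))) ⟩
  row xor (row xor false) ≡⟨ cong (row xor_) (xor-identityʳ row) ⟩
  row xor row             ≡⟨ xor-same row ⟩
  false                   ∎
  where
  open ≡-Reasoning
  row = ∑[ j < n ] B zero (suc j)

·-selfAdjoint : (H : Fin n → Fin n → Bool) → (∀ i j → H i j ≡ H j i) → (x y : Fin n → Bool) →
                x · (λ i → H i · y) ≡ y · (λ i → H i · x)
·-selfAdjoint {n} H H-sym x y = begin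
  ∑[ i < n ] (x i ∧ (H i · y))                     ≡⟨ sum-cong-≗ (λ i → *-distribˡ-sum (x i) (λ j → H i j ∧ y j)) ⟩
  ∑[ i < n ] ∑[ j < n ] (x i ∧ (H i j ∧ y j))      ≡⟨ ∑-comm (λ i j → x i ∧ (H i j ∧ y j)) ⟩
  ∑[ j < n ] ∑[ i < n ] (x i ∧ (H i j ∧ y j))      ≡⟨ sum-cong-≗ (λ j → sum-cong-≗ (λ i → exchange i j)) ⟩
  ∑[ j < n ] ∑[ i < n ] (y j ∧ (H j i ∧ x i))      ≡⟨ sum-cong-≗ (λ j → sym (*-distribˡ-sum (y j) (λ i → H j i ∧ x i))) ⟩
  ∑[ j < n ] (y j ∧ (H j · x))                     ∎
  where
  open ≡-Reasoning
  exchange : ∀ i j → x i ∧ (H i j ∧ y j) ≡ y j ∧ (H j i ∧ x i)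
  exchange i j rewrite H-sym i j = ∧-rotate (x i) (H j i) (y j)

-- The array with entries `y i ∧ (H i j ∧ y j)` inherits symmetry and the zero diagonal from `H`.
·-alternating : (H : Fin n → Fin n → Bool) → (∀ i j → H i j ≡ H j i) → (∀ i → H i i ≡ false) →
                (y : Fin n → Bool) → y · (λ i → H i · y) ≡ false
·-alternating {n} H H-sym H-irrefl y =
  trans (sum-cong-≗ (λ i → *-distribˡ-sum (y i) (λ j → H i j ∧ y j)))
        (∑∑-alternating (λ i j → y i ∧ (H i j ∧ y j)) B-sym B-diag)
  where
  B-sym : ∀ i j → y i ∧ (H i j ∧ y j) ≡ y j ∧ (H j i ∧ y i)
  B-sym i j rewrite H-sym i j = ∧-rotate (y i) (H j i) (y j)
  B-diag : ∀ i → y i ∧ (H i i ∧ y i) ≡ false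
  B-diag i rewrite H-irrefl i = ∧-zeroʳ (y i)

-- The Laplacian L of H is symmetric, so its diagonal deg lies in its column space;
-- the hypothesis says that 1_V = L 1_D does too, hence so does 1_V + deg.
laplacian-solvable :
  (H : Fin n → Fin n → Bool) → (∀ i j → H i j ≡ H j i) → (∀ i → H i i ≡ false) →
  (V D : Fin n → Bool) → (∀ v → (H v · D) xor (D v ∧ sum (H v)) ≡ V v) →
  ∃ λ (S : Fin _ → Bool) → ∀ v → (H v · S) xor (S v ∧ sum (H v)) ≡ V v xor sum (H v)
laplacian-solvable {n} H H-sym H-irrefl V D LD≡V = conclude (fredholm L (λ v → V v xor deg v))
  where
  open ≡-Reasoning
  deg : Fin n → Bool
  deg v = sum (H v)
  -- Signs disappear mod 2, so the Laplacian is `H` plus the diagonal of degree parities.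
  L : Fin n → Fin n → Bool
  L j i = H j i xor (δ j i ∧ deg j)
  Target = ∃ λ (S : Fin _ → Bool) → ∀ v → (H v · S) xor (S v ∧ deg v) ≡ V v xor deg v

  L· : ∀ j y → L j · y ≡ (H j · y) xor (y j ∧ deg j)
  L· j y = begin
    L j · y                                           ≡⟨ ·-xorˡ (H j) (λ i → δ j i ∧ deg j) y ⟩
    (H j · y) xor ∑[ i < n ] ((δ j i ∧ deg j) ∧ y i)   ≡⟨ cong ((H j · y) xor_) (sum-cong-≗ (λ i → ∧-assoc (δ j i) (deg j) (y i))) ⟩
    (H j · y) xor ∑[ i < n ] (δ j i ∧ (deg j ∧ y i))   ≡⟨ cong ((H j · y) xor_) (∑-δ j (λ i → deg j ∧ y i)) ⟩
    (H j · y) xor (deg j ∧ y j)                       ≡⟨ cong ((H j · y) xor_) (∧-comm (deg j) (y j)) ⟩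
    (H j · y) xor (y j ∧ deg j)                       ∎

  L-sym : ∀ i j → L i j ≡ L j i
  L-sym i j with i ≟ j | j ≟ i
  ... | yes refl | yes _  = refl
  ... | yes refl | no i≢i = contradiction refl i≢i
  ... | no i≢j   | yes eq = contradiction (sym eq) i≢j
  ... | no _     | no _   = cong (_xor false) (H-sym i j)

  xor≡false⇒≡ : ∀ a {b} → a xor b ≡ false → a ≡ b
  xor≡false⇒≡ false       eq = sym eq
  xor≡false⇒≡ true {true} eq = refl

  conclude : _ → Target
  -- `fredholm` combines the rows of `L`, while the goal applies `L` to `x`; symmetry of `L`
  -- identifies the two.
  conclude (inj₁ (x , eq)) = x , λ v → begin
    (H v · x) xor (x v ∧ deg v)    ≡⟨ sym (L· v x) ⟩
    L v · x                        ≡⟨ ·-comm (L v) x ⟩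
    ∑[ j < n ] (x j ∧ L v j)       ≡⟨ sum-cong-≗ (λ j → cong (x j ∧_) (L-sym v j)) ⟩
    ∑[ j < n ] (x j ∧ L j v)       ≡⟨ eq v ⟩
    V v xor deg v                  ∎
  -- Any `y` in the kernel of `L` is orthogonal to `deg` and to `V` separately, so it cannot witness
  -- `by`.
  conclude (inj₂ (y , Ly≡0 , by)) = contradiction (trans (·-xorˡ V deg y) (cong₂ _xor_ V·y deg·y)) (true≢false by)
    where
    Hy : ∀ j → H j · y ≡ y j ∧ deg j
    Hy j = xor≡false⇒≡ (H j · y) (trans (sym (L· j y)) (Ly≡0 j))
    -- Idempotence of `y j` turns the linear form `deg · y` into a quadratic one, which `Hy`
    -- rewrites as the alternating form of `H` at `y`.
    deg·y : deg · y ≡ false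
    deg·y = begin
      deg · y                        ≡⟨ ·-comm deg y ⟩
      ∑[ j < n ] (y j ∧ deg j)       ≡⟨ sum-cong-≗ (λ j → trans (cong (_∧ deg j) (sym (∧-idem (y j)))) (∧-assoc (y j) (y j) (deg j))) ⟩
      y · (λ j → y j ∧ deg j)        ≡⟨ sum-cong-≗ (λ j → cong (y j ∧_) (sym (Hy j))) ⟩
      y · (λ j → H j · y)            ≡⟨ ·-alternating H H-sym H-irrefl y ⟩
      false                          ∎
    ∧-swap : ∀ a b c → a ∧ (b ∧ c) ≡ b ∧ (a ∧ c)
    ∧-swap true  b c = refl
    ∧-swap false b c = sym (∧-zeroʳ b)
    -- As `V = L D` and `L` is self-adjoint, `V · y = D · (L y) = 0`; the adjacency and the diagonal
    -- part are moved across separately.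
    V·y : V · y ≡ false
    V·y = begin
      V · y                                                        ≡⟨ ·-comm V y ⟩
      y · V                                                        ≡⟨ sum-cong-≗ (λ j → cong (y j ∧_) (sym (LD≡V j))) ⟩
      y · (λ j → (H j · D) xor (D j ∧ deg j))                       ≡⟨ ·-xorʳ y (λ j → H j · D) (λ j → D j ∧ deg j) ⟩
      (y · (λ j → H j · D)) xor (y · (λ j → D j ∧ deg j))           ≡⟨ cong₂ _xor_ (·-selfAdjoint H H-sym y D) (sum-cong-≗ (λ j → ∧-swap (y j) (D j) (deg j))) ⟩
      (D · (λ j → H j · y)) xor (D · (λ j → y j ∧ deg j))           ≡⟨ cong (_xor (D · (λ j → y j ∧ deg j))) (sum-cong-≗ (λ j → cong (D j ∧_) (Hy j))) ⟩
      (D · (λ j → y j ∧ deg j)) xor (D · (λ j → y j ∧ deg j))       ≡⟨ xor-same (D · (λ j → y j ∧ deg j)) ⟩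
      false                                                        ∎

-- Induced subgraphs with odd degrees

-- In the subgraph induced on the union `V` of `D` and `P`, the hypotheses give `L D = V`, so some
-- `S` satisfies `L S = V + deg`. At a vertex of `V` in `S` this makes the number of neighbours in
-- `S` odd, and at the other vertices of `V` the number of neighbours in `V` outside `S`. The larger
-- of the two classes has at least half of `V`.
oddCut⇒oddInduced :
  (G : Graph n) (D P : Fin n → Bool) → (∀ v → D v ≡ true → P v ≡ false) →
  (∀ v → D v ≡ true → adj G v · P ≡ true) → (∀ v → P v ≡ true → adj G v · D ≡ true) →
  ∃ λ (S : Fin n → Bool) →
    (countTrue D + countTrue P ≤ 2 * countTrue S) × (∀ v → S v ≡ true → adj G v · S ≡ true)
oddCut⇒oddInduced {n} G D P D∩P≡∅ D-odd P-odd =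
  [ (λ S₂≤S₁ → S₁ , large _ ≤-refl S₂≤S₁ , S₁-odd) , (λ S₁≤S₂ → S₂ , large _ S₁≤S₂ ≤-refl , S₂-odd) ]′
    (≤-total (countTrue S₂) (countTrue S₁))
  where
  -- For disjoint `D` and `P` the xor is their union, and it makes sums over `V` split linearly.
  V : Fin n → Bool
  V v = D v xor P v

  -- The induced subgraph keeps the index set `Fin n`; vertices outside `V` become isolated, so
  -- there both sides of the Laplacian equation vanish.
  H : Fin n → Fin n → Bool
  H u v = V u ∧ (adj G u v ∧ V v)

  H-sym : ∀ u v → H u v ≡ H v u
  H-sym u v rewrite adj-sym G u v with V u | V v
  ... | true  | true  = refl
  ... | true  | false = ∧-zeroʳ (adj G v u)
  ... | false | true  = sym (∧-zeroʳ (adj G v u))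
  ... | false | false = refl

  H-irrefl : ∀ v → H v v ≡ false
  H-irrefl v rewrite adj-irrefl G v = ∧-zeroʳ (V v)

  H·-inside : ∀ v T → V v ≡ true → H v · T ≡ adj G v · (λ u → V u ∧ T u)
  H·-inside v T v∈V rewrite v∈V = sum-cong-≗ (λ u → ∧-assoc (adj G v u) (V u) (T u))

  deg-inside : ∀ v → V v ≡ true → sum (H v) ≡ adj G v · V
  deg-inside v v∈V rewrite v∈V = refl

  V∧D : ∀ v → V v ∧ D v ≡ D v
  V∧D v with D v in v∈D
  ... | true rewrite D∩P≡∅ v v∈D = refl
  ... | false = ∧-zeroʳ (P v)

  H·D : ∀ v → V v ≡ true → H v · D ≡ adj G v · D
  H·D v v∈V = trans (H·-inside v D v∈V) (sum-cong-≗ (λ u → cong (adj G v u ∧_) (V∧D u)))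

  V-D : ∀ {v} → D v ≡ true → V v ≡ true
  V-D {v} v∈D = cong₂ _xor_ v∈D (D∩P≡∅ v v∈D)

  -- Neighbours in `D` are counted once by `H v · D` and once by the degree; they cancel and leave
  -- the odd number of neighbours in `P`.
  cut-D : ∀ v → D v ≡ true → (H v · D) xor (D v ∧ sum (H v)) ≡ true
  cut-D v v∈D = begin
    (H v · D) xor (D v ∧ sum (H v))                     ≡⟨ cong₂ _xor_ (H·D v (V-D v∈D)) (trans (cong (_∧ sum (H v)) v∈D) (deg-inside v (V-D v∈D))) ⟩
    (adj G v · D) xor (adj G v · V)                     ≡⟨ cong ((adj G v · D) xor_) (·-xorʳ (adj G v) D P) ⟩
    (adj G v · D) xor ((adj G v · D) xor (adj G v · P)) ≡⟨ cong (λ b → (adj G v · D) xor ((adj G v · D) xor b)) (D-odd v v∈D) ⟩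
    (adj G v · D) xor ((adj G v · D) xor true)          ≡⟨ cancel (adj G v · D) ⟩
    true                                                ∎
    where
    open ≡-Reasoning
    cancel : ∀ a → a xor (a xor true) ≡ true
    cancel true  = refl
    cancel false = refl

  cut-∉D : ∀ v → D v ≡ false → (H v · D) xor (D v ∧ sum (H v)) ≡ H v · D
  cut-∉D v v∉D = trans (cong (λ b → (H v · D) xor (b ∧ sum (H v))) v∉D) (xor-identityʳ (H v · D))

  cut : ∀ v → (H v · D) xor (D v ∧ sum (H v)) ≡ V v
  cut v = cases (D v Bool.≟ true) (P v Bool.≟ true)
    where
    cases : Dec (D v ≡ true) → Dec (P v ≡ true) → (H v · D) xor (D v ∧ sum (H v)) ≡ V v
    cases (yes v∈D) _ = trans (cut-D v v∈D) (sym (V-D v∈D))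
    cases (no v∉D) (yes v∈P) = trans (cut-∉D v (Bool.¬-not v∉D)) (trans (H·D v v∈V) (trans (P-odd v v∈P) (sym v∈V)))
      where v∈V = cong₂ _xor_ (Bool.¬-not v∉D) v∈P
    cases (no v∉D) (no v∉P) = trans (cut-∉D v (Bool.¬-not v∉D)) (trans (sum-false _ (λ u → cong (λ b → (b ∧ (adj G v u ∧ V u)) ∧ D u) v∉V)) (sym v∉V))
      where v∉V = cong₂ _xor_ (Bool.¬-not v∉D) (Bool.¬-not v∉P)

  solution = laplacian-solvable H H-sym H-irrefl V D cut
  S = proj₁ solution

  S₁ S₂ : Fin n → Bool
  S₁ v = V v ∧ S v
  S₂ v = V v ∧ not (S v)

  -- On `S` the diagonal term equals the degree and cancels against the degree on the right.
  S₁-odd : ∀ v → S₁ v ≡ true → adj G v · S₁ ≡ true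
  S₁-odd v v∈S₁ = trans (sym (H·-inside v S v∈V)) (cancel (H v · S) (sum (H v)) (begin
    (H v · S) xor sum (H v)            ≡⟨ cong (λ b → (H v · S) xor (b ∧ sum (H v))) (sym (∧-trueʳ {V v} v∈S₁)) ⟩
    (H v · S) xor (S v ∧ sum (H v))    ≡⟨ proj₂ solution v ⟩
    V v xor sum (H v)                  ≡⟨ cong (_xor sum (H v)) v∈V ⟩
    true xor sum (H v)                 ∎))
    where
    open ≡-Reasoning
    v∈V = ∧-trueˡ v∈S₁
    cancel : ∀ a b → a xor b ≡ true xor b → a ≡ true
    cancel true  b     _ = refl
    cancel false true  ()
    cancel false false ()

  -- Off `S` the diagonal term is zero, so the equation reads `H v · S = 1 + deg v`; the remaining
  -- neighbours in `V` then number 1 mod 2.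
  S₂-odd : ∀ v → S₂ v ≡ true → adj G v · S₂ ≡ true
  S₂-odd v v∈S₂ = begin
    adj G v · S₂                             ≡⟨ sum-cong-≗ (λ u → cong (adj G v u ∧_) (∧-not (V u) (S u))) ⟩
    adj G v · (λ u → V u xor S₁ u)           ≡⟨ ·-xorʳ (adj G v) V S₁ ⟩
    (adj G v · V) xor (adj G v · S₁)         ≡⟨ cong₂ _xor_ (sym (deg-inside v v∈V)) (sym (H·-inside v S v∈V)) ⟩
    sum (H v) xor (H v · S)                  ≡⟨ cong (sum (H v) xor_) H·S ⟩
    sum (H v) xor (true xor sum (H v))       ≡⟨ complement (sum (H v)) ⟩
    true                                     ∎
    where
    open ≡-Reasoning
    v∈V = ∧-trueˡ v∈S₂
    ∧-not : ∀ a b → a ∧ not b ≡ a xor (a ∧ b)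
    ∧-not true  b = refl
    ∧-not false b = refl
    complement : ∀ a → a xor (true xor a) ≡ true
    complement true  = refl
    complement false = refl
    H·S : H v · S ≡ true xor sum (H v)
    H·S = begin
      H v · S                            ≡⟨ sym (xor-identityʳ (H v · S)) ⟩
      (H v · S) xor false                ≡⟨ cong (λ b → (H v · S) xor (b ∧ sum (H v))) (sym (not-true⇒false (∧-trueʳ {V v} v∈S₂))) ⟩
      (H v · S) xor (S v ∧ sum (H v))    ≡⟨ proj₂ solution v ⟩
      V v xor sum (H v)                  ≡⟨ cong (_xor sum (H v)) v∈V ⟩
      true xor sum (H v)                 ∎

  -- Here `k` stands for the size of the larger class, so that one computation serves both cases.
  large : ∀ k → countTrue S₁ ≤ k → countTrue S₂ ≤ k → countTrue D + countTrue P ≤ 2 * k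
  large k S₁≤k S₂≤k = begin
    countTrue D + countTrue P   ≤⟨ countTrue-disjoint D P V (λ v → V-D) P⊆V D∩P≡∅ ⟩
    countTrue V                 ≤⟨ countTrue-∪ V S₁ S₂ (λ v v∈V → split v v∈V) ⟩
    countTrue S₁ + countTrue S₂ ≤⟨ +-mono-≤ S₁≤k S₂≤k ⟩
    k + k                       ≡⟨ solve 1 (λ x → x :+ x := con 2 :* x) refl k ⟩
    2 * k                       ∎
    where
    open ≤-Reasoning
    open +-*-Solver
    P⊆V : ∀ v → P v ≡ true → V v ≡ true
    P⊆V v v∈P with D v in v∈D
    ... | true  = contradiction (D∩P≡∅ v v∈D) (true≢false v∈P)
    ... | false = v∈P
    split : ∀ v → V v ≡ true → S₁ v ≡ true ⊎ S₂ v ≡ true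
    split v v∈V with S v
    ... | true  = inj₁ (∧-true v∈V refl)
    ... | false = inj₂ (∧-true v∈V refl)

-- Each row with r i zero ≡ true is decided by the coordinate zero of s, which is chosen
-- last, to suit the majority of those rows.
half-odd : (X : Fin m → Bool) (r : Fin m → Fin n → Bool) → (∀ i → X i ≡ true → ∃ λ j → r i j ≡ true) →
           ∃ λ (s : Fin n → Bool) → countTrue X ≤ 2 * countTrue (λ i → X i ∧ (r i · s))
-- A row of length zero has no true entry, so `X` is empty.
half-odd {m} {zero} X r r≢0 = (λ ()) , ≤-trans (countTrue-mono X (λ _ → false) (λ i i∈X → contradiction (proj₁ (r≢0 i i∈X)) λ ())) (≤-trans (≤-reflexive (countTrue-false m)) z≤n)
half-odd {m} {suc n} X r r≢0 =
  [ (λ B≤A → false ∷ s , bound A (λ i → X i ∧ (r i · (false ∷ s))) ≤-refl B≤A (λ i → A⇒ (X i) (r i zero)) (λ i → C⇒ (X i) (r i zero)) disjA)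
  , (λ A≤B → true  ∷ s , bound B (λ i → X i ∧ (r i · (true ∷ s))) A≤B ≤-refl (λ i → B⇒ (X i) (r i zero)) (λ i → C⇒ (X i) (r i zero)) disjB)
  ]′ (≤-total (countTrue B) (countTrue A))
  where
  X′ : Fin m → Bool
  X′ i = X i ∧ not (r i zero)
  r′ : Fin m → Fin n → Bool
  r′ i = r i ∘ suc
  r′≢0 : ∀ i → X′ i ≡ true → ∃ λ j → r′ i j ≡ true
  r′≢0 i i∈X′ with r≢0 i (∧-trueˡ i∈X′)
  ... | suc j , p = j , p
  ... | zero  , p = contradiction (not-true⇒false (∧-trueʳ {X i} i∈X′)) (true≢false p)
  ih = half-odd X′ r′ r′≢0
  s = proj₁ ih
  -- With head coordinate `true` in the row, `A` collects the rows made odd by `false ∷ s` and `B`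
  -- those made odd by `true ∷ s`. The rows in `C` have head `false` and are odd under either
  -- choice.
  A B C : Fin m → Bool
  A i = X i ∧ (r i zero ∧ (r′ i · s))
  B i = X i ∧ (r i zero ∧ not (r′ i · s))
  C i = X′ i ∧ (r′ i · s)
  A⇒ : ∀ x a {t} → x ∧ (a ∧ t) ≡ true → x ∧ ((a ∧ false) xor t) ≡ true
  A⇒ true true p = p
  B⇒ : ∀ x a {t} → x ∧ (a ∧ not t) ≡ true → x ∧ ((a ∧ true) xor t) ≡ true
  B⇒ true true p = p
  C⇒ : ∀ x a {b t} → (x ∧ not a) ∧ t ≡ true → x ∧ ((a ∧ b) xor t) ≡ true
  C⇒ true false p = p
  disj : ∀ x a {t u} → x ∧ (a ∧ t) ≡ true → (x ∧ not a) ∧ u ≡ false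
  disj true true p = refl
  disjA : ∀ i → A i ≡ true → C i ≡ false
  disjA i = disj (X i) (r i zero)
  disjB : ∀ i → B i ≡ true → C i ≡ false
  disjB i = disj (X i) (r i zero)
  bound : ∀ M Q → countTrue A ≤ countTrue M → countTrue B ≤ countTrue M →
          (∀ i → M i ≡ true → Q i ≡ true) → (∀ i → C i ≡ true → Q i ≡ true) → (∀ i → M i ≡ true → C i ≡ false) →
          countTrue X ≤ 2 * countTrue Q
  bound M Q A≤M B≤M M⊆Q C⊆Q M∩C≡∅ = begin
    countTrue X                                       ≤⟨ countTrue-∪ X (λ i → X i ∧ r i zero) X′ (λ i → split₁ (X i) (r i zero)) ⟩
    countTrue (λ i → X i ∧ r i zero) + countTrue X′   ≤⟨ +-mono-≤ (countTrue-∪ _ A B (λ i → split₂ (X i) (r i zero))) (proj₂ ih) ⟩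
    countTrue A + countTrue B + 2 * countTrue C       ≤⟨ +-mono-≤ (+-mono-≤ A≤M B≤M) ≤-refl ⟩
    countTrue M + countTrue M + 2 * countTrue C       ≡⟨ solve 2 (λ x y → x :+ x :+ con 2 :* y := con 2 :* (x :+ y)) refl (countTrue M) (countTrue C) ⟩
    2 * (countTrue M + countTrue C)                   ≤⟨ *-monoʳ-≤ 2 (countTrue-disjoint M C Q M⊆Q C⊆Q M∩C≡∅) ⟩
    2 * countTrue Q                                   ∎
    where
    open ≤-Reasoning
    open +-*-Solver
    split₁ : ∀ x a → x ≡ true → x ∧ a ≡ true ⊎ x ∧ not a ≡ true
    split₁ true true  _ = inj₁ refl
    split₁ true false _ = inj₂ refl
    split₂ : ∀ x a {t} → x ∧ a ≡ true → x ∧ (a ∧ t) ≡ true ⊎ x ∧ (a ∧ not t) ≡ true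
    split₂ true true {true}  _ = inj₁ refl
    split₂ true true {false} _ = inj₂ refl

-- Minimal vertex covers and minimal dominating sets

minimal-subset : {P : (Fin n → Bool) → Set} → (∀ D → Dec (P D)) → ∀ D → P D →
                 ∃ λ D′ → P D′ × (∀ d → D′ d ≡ true → ¬ P (D′ ∖ d))
minimal-subset {n} {P} P? D₀ = shrink (countTrue D₀) D₀ ≤-refl
  where
  -- `k` bounds the size of `D` and serves as the recursion measure; at `k = 0` nothing can be
  -- removed, so only `suc k′` occurs below.
  shrink : ∀ k D → countTrue D ≤ k → P D → ∃ λ D′ → P D′ × (∀ d → D′ d ≡ true → ¬ P (D′ ∖ d))
  shrink k D size PD with any? (λ d → (D d Bool.≟ true) ×-dec P? (D ∖ d))
  ... | no  ¬removable = D , PD , λ d d∈D PD∖d → ¬removable (d , d∈D , PD∖d)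
  ... | yes (d , d∈D , PD∖d) with k | ≤-trans (countTrue-strict (D ∖ d) D (λ i → ∧-trueˡ) d d∈D (∉-∖ D d)) size
  ...   | suc k′ | s≤s size′ = shrink k′ (D ∖ d) size′ PD∖d

-- The complement of a minimal vertex cover is a maximal independent set.
bipartition : (G : Graph n) → minDegree≥ G 1 →
              ∃ λ (C : Fin n → Bool) → ∀ v → ∃ λ u → adj G v u ≡ true × C u ≡ not (C v)
bipartition {n} G δ≥1 = C , opposite
  where
  Cover : (Fin n → Bool) → Set
  Cover C = ∀ u v → adj G u v ≡ true → C u ≡ true ⊎ C v ≡ true

  minimal = minimal-subset {P = Cover}
    (λ C → all? λ u → all? λ v → (adj G u v Bool.≟ true) →-dec ((C u Bool.≟ true) ⊎-dec (C v Bool.≟ true)))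
    (λ _ → true) (λ _ _ _ → inj₁ refl)
  C       = proj₁ minimal
  C-cover = proj₁ (proj₂ minimal)

  adj⇒≢ : ∀ {u v} → adj G u v ≡ true → u ≢ v
  adj⇒≢ {u} uv refl = true≢false uv (adj-irrefl G u)

  -- Every edge at `d` is still covered from its other end. Minimality therefore gives each vertex
  -- of `C` a neighbour outside `C`.
  removable : ∀ d → (∀ u → adj G d u ≡ true → C u ≡ true) → Cover (C ∖ d)
  removable d N⊆C u v uv with u ≟ d | v ≟ d
  ... | yes refl | yes refl = contradiction refl (adj⇒≢ uv)
  ... | yes refl | no v≢d   = inj₂ (∧-true (N⊆C v uv) refl)
  ... | no u≢d   | yes refl = inj₁ (∧-true (N⊆C u (trans (adj-sym G d u) uv)) refl)
  ... | no _     | no _     = [ (λ u∈C → inj₁ (∧-true u∈C refl)) , (λ v∈C → inj₂ (∧-true v∈C refl)) ]′ (C-cover u v uv)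

  opposite : ∀ v → ∃ λ u → adj G v u ≡ true × C u ≡ not (C v)
  opposite v with C v in Cv
  ... | false with countTrue>0 (adj G v) (δ≥1 v)
  ...   | u , vu = u , vu , [ (λ v∈C → contradiction Cv (true≢false v∈C)) , (λ u∈C → u∈C) ]′ (C-cover v u vu)
  opposite v | true with any? (λ u → (adj G v u Bool.≟ true) ×-dec (C u Bool.≟ false))
  ... | yes found = found
  ... | no  none  = contradiction (removable v (λ u vu → Bool.¬-not (λ u∉C → none (u , vu , u∉C))))
                                  (proj₂ (proj₂ minimal) v Cv)

-- Choose `D` inclusion-minimal among the subsets of `Y` that dominate `X`. Deleting `d` leaves some
-- vertex of `X` undominated, and the only neighbour of that vertex in `D` is `d`.
private-neighbours :
  (G : Graph n) (X Y : Fin n → Bool) → (∀ i → X i ≡ true → ∃ λ j → adj G i j ≡ true × Y j ≡ true) →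
  ∃ λ (D : Fin n → Bool) →
    (∀ d → D d ≡ true → Y d ≡ true) ×
    (∀ i → X i ≡ true → ∃ λ j → adj G i j ≡ true × D j ≡ true) ×
    (∀ d → D d ≡ true → ∃ λ i → X i ≡ true × adj G i d ≡ true × (∀ j → adj G i j ≡ true → D j ≡ true → j ≡ d))
private-neighbours {n} G X Y dom = D , D⊆Y , D-dom , has-private
  where
  Dominating : (Fin n → Bool) → Set
  Dominating D = (∀ d → D d ≡ true → Y d ≡ true) × (∀ i → X i ≡ true → ∃ λ j → adj G i j ≡ true × D j ≡ true)

  minimal = minimal-subset {P = Dominating}
    (λ D → all? (λ d → (D d Bool.≟ true) →-dec (Y d Bool.≟ true)) ×-dec
           all? (λ i → (X i Bool.≟ true) →-dec any? (λ j → (adj G i j Bool.≟ true) ×-dec (D j Bool.≟ true))))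
    Y ((λ d d∈Y → d∈Y) , dom)
  D     = proj₁ minimal
  D⊆Y   = proj₁ (proj₁ (proj₂ minimal))
  D-dom = proj₂ (proj₁ (proj₂ minimal))

  Private : Fin n → Fin n → Set
  Private d i = X i ≡ true × adj G i d ≡ true × (∀ j → adj G i j ≡ true → D j ≡ true → j ≡ d)

  Private? : ∀ d i → Dec (Private d i)
  Private? d i = (X i Bool.≟ true) ×-dec (adj G i d Bool.≟ true) ×-dec
    all? (λ j → (adj G i j Bool.≟ true) →-dec ((D j Bool.≟ true) →-dec (j ≟ d)))

  -- A vertex of `X` with no neighbour in `D` other than `d` still has one in `D`; this must be `d`,
  -- which makes the vertex private to `d`.
  still-dominated : ∀ d → ¬ (∃ λ i → Private d i) → ∀ i → X i ≡ true → ∃ λ j → adj G i j ≡ true × (D ∖ d) j ≡ true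
  still-dominated d none i i∈X with any? (λ j → (adj G i j Bool.≟ true) ×-dec ((D ∖ d) j Bool.≟ true))
  ... | yes found = found
  ... | no  alone = contradiction (i , i∈X , subst (λ j → adj G i j ≡ true) (only-d j₀ ij₀ j₀∈D) ij₀ , only-d) none
    where
    only-d : ∀ j → adj G i j ≡ true → D j ≡ true → j ≡ d
    only-d j ij j∈D with j ≟ d
    ... | yes j≡d = j≡d
    ... | no  j≢d = contradiction (j , ij , ∈-∖ D j∈D j≢d) alone
    j₀   = proj₁ (D-dom i i∈X)
    ij₀  = proj₁ (proj₂ (D-dom i i∈X))
    j₀∈D = proj₂ (proj₂ (D-dom i i∈X))

  has-private : ∀ d → D d ≡ true → ∃ (Private d)
  has-private d d∈D with any? (Private? d)
  ... | yes found = found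
  ... | no  none  = contradiction ((λ j j∈D∖d → D⊆Y j (∧-trueˡ j∈D∖d)) , still-dominated d none)
                                  (proj₂ (proj₂ minimal) d d∈D)

-- Take D ⊆ Y minimal dominating X and D′ ⊆ D with at least half of X odd to D′. A vertex of D′
-- of the wrong degree is repaired by toggling its private neighbour, which affects no other
-- vertex of D′; the private neighbours lost are at most as many as the vertices of D′ gained.
dominated⇒oddCut :
  (G : Graph n) (X Y : Fin n → Bool) → (∀ v → Y v ≡ true → X v ≡ false) →
  (∀ i → X i ≡ true → ∃ λ j → adj G i j ≡ true × Y j ≡ true) →
  ∃ λ (D : Fin n → Bool) → ∃ λ (P : Fin n → Bool) →
    (∀ v → D v ≡ true → P v ≡ false) ×
    (∀ v → D v ≡ true → adj G v · P ≡ true) × (∀ v → P v ≡ true → adj G v · D ≡ true) ×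
    (countTrue X ≤ 2 * (countTrue D + countTrue P))
dominated⇒oddCut {n} G X Y Y∩X≡∅ dom with private-neighbours G X Y dom
... | D , D⊆Y , D-dom , D-private
  with half-odd X (λ i j → adj G i j ∧ D j) (λ i i∈X → let j , ij , j∈D = D-dom i i∈X in j , ∧-true ij j∈D)
... | s , half = D′ , P , disjoint , D′-odd , P-odd , size
  where
  Private : Fin n → Fin n → Set
  Private d i = X i ≡ true × adj G i d ≡ true × (∀ j → adj G i j ≡ true → D j ≡ true → j ≡ d)

  -- Membership in `D` is assumed inside the pair so that `p` is a total function; outside `D` its
  -- value `d` is a dummy.
  private-of : ∀ d → ∃ λ i → D d ≡ true → Private d i
  private-of d with D d Bool.≟ true
  ... | yes d∈D = let i , pr = D-private d d∈D in i , λ _ → pr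
  ... | no  d∉D = d , λ d∈D → contradiction d∈D d∉D

  p : Fin n → Fin n
  p d = proj₁ (private-of d)

  -- `Z` is the part of `X` odd to `D′`, `e` marks the vertices of `D′` with evenly many neighbours
  -- in `Z`, and `R` holds their private neighbours. Writing `R` as a sum and `P` as a symmetric
  -- difference keeps neighbour counts linear.
  D′ Z e R P : Fin n → Bool
  D′ d = D d ∧ s d
  Z i  = X i ∧ (adj G i · D′)
  e d  = D′ d ∧ not (adj G d · Z)
  R i  = ∑[ d < n ] (e d ∧ δ (p d) i)
  P i  = Z i xor R i

  R⇒ : ∀ i → R i ≡ true → ∃ λ d → D′ d ≡ true × i ≡ p d
  R⇒ i i∈R = let d , q = sum-true⇒∃ _ i∈R in
    d , ∧-trueˡ (∧-trueˡ {e d} q) , sym (δ⇒≡ {a = p d} (∧-trueʳ {e d} q))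

  -- The private neighbour of `d` sees exactly one vertex of `D′`, namely `d`.
  p-odd : ∀ d → D′ d ≡ true → adj G (p d) · D′ ≡ true
  p-odd d d∈D′ = trans (sum-cong-≗ only-d) (∑-δ d (λ _ → true))
    where
    pr = proj₂ (private-of d) (∧-trueˡ d∈D′)
    only-d : ∀ j → adj G (p d) j ∧ D′ j ≡ δ d j ∧ true
    only-d j = ⇔→≡ {z = true} (mk⇔
      (λ q → ∧-true (≡⇒δ {a = d} (sym (proj₂ (proj₂ pr) j (∧-trueˡ q) (∧-trueˡ (∧-trueʳ {adj G (p d) j} q))))) refl)
      (λ q → subst (λ k → adj G (p d) k ∧ D′ k ≡ true) (δ⇒≡ {a = d} (∧-trueˡ q)) (∧-true (proj₁ (proj₂ pr)) d∈D′)))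

  P-odd : ∀ v → P v ≡ true → adj G v · D′ ≡ true
  P-odd v v∈P with xor-true (Z v) v∈P
  ... | inj₁ v∈Z = ∧-trueʳ {X v} v∈Z
  ... | inj₂ v∈R with R⇒ v v∈R
  ...   | d , d∈D′ , refl = p-odd d d∈D′

  P⊆X : ∀ v → P v ≡ true → X v ≡ true
  P⊆X v v∈P with xor-true (Z v) v∈P
  ... | inj₁ v∈Z = ∧-trueˡ v∈Z
  ... | inj₂ v∈R with R⇒ v v∈R
  ...   | d , d∈D′ , refl = proj₁ (proj₂ (private-of d) (∧-trueˡ d∈D′))

  disjoint : ∀ v → D′ v ≡ true → P v ≡ false
  disjoint v v∈D′ = Bool.¬-not (λ v∈P → true≢false (P⊆X v v∈P) (Y∩X≡∅ v (D⊆Y v (∧-trueˡ v∈D′))))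

  -- After exchanging sums, the term of `c` asks whether `d` is adjacent to the private neighbour of
  -- `c`, which forces `c = d`.
  adj·R : ∀ d → D′ d ≡ true → adj G d · R ≡ e d
  adj·R d d∈D′ = begin
    ∑[ i < n ] (adj G d i ∧ R i)                                 ≡⟨ sum-cong-≗ (λ i → *-distribˡ-sum (adj G d i) (λ c → e c ∧ δ (p c) i)) ⟩
    ∑[ i < n ] ∑[ c < n ] (adj G d i ∧ (e c ∧ δ (p c) i))        ≡⟨ ∑-comm (λ i c → adj G d i ∧ (e c ∧ δ (p c) i)) ⟩
    ∑[ c < n ] ∑[ i < n ] (adj G d i ∧ (e c ∧ δ (p c) i))        ≡⟨ sum-cong-≗ (λ c → sum-cong-≗ (λ i → ∧-rotate (adj G d i) (e c) (δ (p c) i))) ⟩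
    ∑[ c < n ] ∑[ i < n ] (δ (p c) i ∧ (e c ∧ adj G d i))        ≡⟨ sum-cong-≗ (λ c → ∑-δ (p c) (λ i → e c ∧ adj G d i)) ⟩
    ∑[ c < n ] (e c ∧ adj G d (p c))                             ≡⟨ sum-cong-≗ only-d ⟩
    ∑[ c < n ] (δ d c ∧ e c)                                     ≡⟨ ∑-δ d e ⟩
    e d                                                          ∎
    where
    open ≡-Reasoning
    only-d : ∀ c → e c ∧ adj G d (p c) ≡ δ d c ∧ e c
    only-d c = ⇔→≡ {z = true} (mk⇔
      (λ q → let pr = proj₂ (private-of c) (∧-trueˡ (∧-trueˡ (∧-trueˡ {e c} q))) in
        ∧-true (≡⇒δ {a = d} (proj₂ (proj₂ pr) d (trans (adj-sym G (p c) d) (∧-trueʳ {e c} q)) (∧-trueˡ d∈D′))) (∧-trueˡ q))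
      (λ q → subst (λ c → e c ≡ true → e c ∧ adj G d (p c) ≡ true) (δ⇒≡ {a = d} (∧-trueˡ q))
        (λ d∈e → ∧-true d∈e (trans (adj-sym G d (p d)) (proj₁ (proj₂ (proj₂ (private-of d) (∧-trueˡ d∈D′))))))
        (∧-trueʳ {δ d c} q)))

  D′-odd : ∀ d → D′ d ≡ true → adj G d · P ≡ true
  D′-odd d d∈D′ = begin
    adj G d · P                                ≡⟨ ·-xorʳ (adj G d) Z R ⟩
    (adj G d · Z) xor (adj G d · R)            ≡⟨ cong ((adj G d · Z) xor_) (adj·R d d∈D′) ⟩
    (adj G d · Z) xor e d                      ≡⟨ cong (λ b → (adj G d · Z) xor (b ∧ not (adj G d · Z))) d∈D′ ⟩
    (adj G d · Z) xor not (adj G d · Z)        ≡⟨ complement (adj G d · Z) ⟩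
    true                                       ∎
    where
    open ≡-Reasoning
    complement : ∀ a → a xor not a ≡ true
    complement true  = refl
    complement false = refl

  size : countTrue X ≤ 2 * (countTrue D′ + countTrue P)
  size = begin
    countTrue X                                                           ≤⟨ half ⟩
    2 * countTrue (λ i → X i ∧ ((λ j → adj G i j ∧ D j) · s))    ≤⟨ *-monoʳ-≤ 2 (countTrue-mono _ Z (λ i → subst (λ b → X i ∧ b ≡ true) (sum-cong-≗ (λ j → ∧-assoc (adj G i j) (D j) (s j))))) ⟩
    2 * countTrue Z                                                       ≤⟨ *-monoʳ-≤ 2 (countTrue-∪ Z R P (λ i → cover (Z i) (R i))) ⟩
    2 * (countTrue R + countTrue P)                                       ≤⟨ *-monoʳ-≤ 2 (+-mono-≤ R≤D′ ≤-refl) ⟩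
    2 * (countTrue D′ + countTrue P)                                      ∎
    where
    open ≤-Reasoning
    R≤D′ : countTrue R ≤ countTrue D′
    R≤D′ = ≤-trans (countTrue-image e p) (countTrue-mono e D′ (λ d → ∧-trueˡ))
    cover : ∀ z r → z ≡ true → r ≡ true ⊎ z xor r ≡ true
    cover true true  _ = inj₁ refl
    cover true false _ = inj₂ refl

-- Combining the losses into the bound n / 8

oddInduced-of-dominated :
  (G : Graph n) (X Y : Fin n → Bool) → (∀ v → Y v ≡ true → X v ≡ false) →
  (∀ i → X i ≡ true → ∃ λ j → adj G i j ≡ true × Y j ≡ true) →
  ∃ λ (S : Fin n → Bool) → (countTrue X ≤ 4 * countTrue S) × (∀ v → S v ≡ true → adj G v · S ≡ true)
oddInduced-of-dominated G X Y Y∩X≡∅ dom =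
  let D , P , disjoint , D-odd , P-odd , X≤ = dominated⇒oddCut G X Y Y∩X≡∅ dom
      S , D+P≤ , S-odd = oddCut⇒oddInduced G D P disjoint D-odd P-odd
  -- One factor 2 comes from making half of `X` odd, the other from keeping the larger of two odd
  -- classes.
  in S , ≤-trans X≤ (≤-trans (*-monoʳ-≤ 2 D+P≤) (≤-reflexive (sym (*-assoc 2 2 (countTrue S))))) , S-odd

oddInduced-of-larger :
  (G : Graph n) (X Y : Fin n → Bool) → (∀ v → Y v ≡ true → X v ≡ false) → (∀ v → X v ≡ true ⊎ Y v ≡ true) →
  (∀ i → X i ≡ true → ∃ λ j → adj G i j ≡ true × Y j ≡ true) → countTrue Y ≤ countTrue X →
  ∃ λ (S : Fin n → Bool) → (n ≤ 8 * countTrue S) × (∀ v → S v ≡ true → adj G v · S ≡ true)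
oddInduced-of-larger {n} G X Y Y∩X≡∅ X∪Y≡V dom Y≤X =
  let S , X≤4S , S-odd = oddInduced-of-dominated G X Y Y∩X≡∅ dom
  in S , ≤-trans n≤2X (≤-trans (+-mono-≤ X≤4S X≤4S) (≤-reflexive (sym (*-distribʳ-+ (countTrue S) 4 4)))) , S-odd
  where
  open ≤-Reasoning
  -- Taking the larger side as `X` costs the last factor 2, turning 4 into 8.
  n≤2X : n ≤ countTrue X + countTrue X
  n≤2X = begin
    n                               ≡⟨ sym (countTrue-true n) ⟩
    countTrue {n} (λ _ → true)      ≤⟨ countTrue-∪ (λ _ → true) X Y (λ v _ → X∪Y≡V v) ⟩
    countTrue X + countTrue Y       ≤⟨ +-monoʳ-≤ (countTrue X) Y≤X ⟩
    countTrue X + countTrue X       ∎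

oddInduced-linear : (G : Graph n) → minDegree≥ G 1 →
  ∃ λ (S : Fin n → Bool) → (n ≤ 8 * countTrue S) × (∀ v → S v ≡ true → adj G v · S ≡ true)
oddInduced-linear {n} G δ≥1 = from-bipartition (bipartition G δ≥1)
  where
  cover : ∀ b → not b ≡ true ⊎ b ≡ true
  cover true  = inj₂ refl
  cover false = inj₁ refl

  from-bipartition :
    (∃ λ (C : Fin n → Bool) → ∀ v → ∃ λ u → adj G v u ≡ true × C u ≡ not (C v)) →
    ∃ λ (S : Fin n → Bool) → (n ≤ 8 * countTrue S) × (∀ v → S v ≡ true → adj G v · S ≡ true)
  -- Each class dominates the other, so whichever is larger may play the role of `X`.
  from-bipartition (C , opposite) =
    [ oddInduced-of-larger G C̄ C (λ v → cong not) (λ v → cover (C v)) C̄-dom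
    , oddInduced-of-larger G C C̄ (λ v → not-true⇒false) (λ v → swap (cover (C v))) C-dom
    ]′ (≤-total (countTrue C) (countTrue C̄))
    where
    C̄ : Fin n → Bool
    C̄ = not ∘ C

    C-dom : ∀ i → C i ≡ true → ∃ λ j → adj G i j ≡ true × C̄ j ≡ true
    C-dom i i∈C = let j , ij , Cj = opposite i in j , ij , trans (cong not Cj) (trans (not-involutive (C i)) i∈C)

    C̄-dom : ∀ i → C̄ i ≡ true → ∃ λ j → adj G i j ≡ true × C j ≡ true
    C̄-dom i i∈C̄ = let j , ij , Cj = opposite i in j , ij , trans Cj i∈C̄

AllOddInduced-tabulate : (G : Graph n) (S : Fin n → Bool) → (∀ v → S v ≡ true → adj G v · S ≡ true) →
                         AllOddInduced G (tabulate S)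
AllOddInduced-tabulate G S S-odd v v∈S = sum-true⇒Odd (λ u → lookup (tabulate S) u ∧ adj G v u) (begin
  sum (λ u → lookup (tabulate S) u ∧ adj G v u) ≡⟨ sum-cong-≗ (λ u → cong (_∧ adj G v u) (lookup∘tabulate S u)) ⟩
  S · adj G v                                   ≡⟨ ·-comm S (adj G v) ⟩
  adj G v · S                                   ≡⟨ S-odd v (trans (sym (lookup∘tabulate S v)) ([]=⇒lookup v∈S)) ⟩
  true                                          ∎)
  where open ≡-Reasoning

theorem1p3 : (n : ℕ) (G : Graph n) → minDegree≥ G 1 →
    Σ (Subset n) (λ V₀ → (10000 * ∣ V₀ ∣ ≥ n) × AllOddInduced G V₀)
theorem1p3 n G δ≥1 =
  let S , n≤8S , S-odd = oddInduced-linear G δ≥1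
      -- `9992` is `10000 - 8`: the constant 8 is relaxed to the one in the statement.
      size = *-mono-≤ {8} {10000} {countTrue S} {∣ tabulate S ∣} (m≤m+n 8 9992) (≤-reflexive (sym (∣tabulate∣ S)))
  in tabulate S , ≤-trans n≤8S size , AllOddInduced-tabulate G S S-odd
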